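{- Fix $n\ge0$. For every formula $\phi\in\mathcal{L}^1$ and every label $w$, the computation of $\mathtt{Prove_n}(w:\phi)$ terminates.
   Context: Single-agent setting: $Ag=\{1\}$. Formulas $\phi ::= p \mid \overline{p} \mid (\phi\wedge\phi) \mid (\phi\vee\phi) \mid \Box\phi \mid \Diamond\phi \mid [1]\phi \mid \langle 1\rangle\phi$; $\overline{\phi}$ swaps $p/\overline{p}$, $\wedge/\vee$, $\Box/\Diamond$, $[1]/\langle 1\rangle$. A labelled sequent $\mathcal{R},\Gamma$ consists of relational atoms $\mathcal{R}_1xy$ and labelled formulas $x:\phi$. Graphs. $G(\Lambda)$ has the labels of $\Lambda$ as vertices and an edge $(x,y)$ for each $\mathcal{R}_1xy\in\Lambda$. A tree is a graph with a root having exactly one directed path to every other node; a forest is a disjoint union of trees. $\Lambda$ is forestlike iff $G(\Lambda)$ is a forest; its trees are choice-trees; $CT(w)$ is the choice-tree containing $w$. For forestlike $\Lambda$ and label $w$: $w$ is saturated iff (i) $w:\phi\in\Lambda$ implies $w:\overline{\phi}\notin\Lambda$, (ii) $w:\phi\vee\psi\in\Lambda$ implies $w:\phi,w:\psi\in\Lambda$, (iii) $w:\phi\wedge\psi\in\Lambda$ implies $w:\phi\in\Lambda$ or $w:\psi\in\Lambda$. $w$ is $\Box$-realized iff for each $w:\Box\phi\in\Lambda$ some label $u$ has $u:\phi\in\Lambda$; $[1]$-realized iff for each $w:[1]\phi\in\Lambda$ some $u\in CT(w)$ has $u:\phi\in\Lambda$; $\Diamond$-propagated iff for each $w:\Diamond\phi\in\Lambda$,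 $u:\phi\in\Lambda$ for all labels $u$; $\langle1\rangle$-propagated iff for each $w:\langle1\rangle\phi\in\Lambda$, $u:\phi\in\Lambda$ for all $u\in CT(w)$. $\Lambda$ is $n$-choice consistent ($n>0$) iff $G(\Lambda)$ has at most $n$ choice-trees. $\Lambda$ is stable iff all labels are saturated, $\Box$- and $[1]$-realized, $\Diamond$- and $\langle1\rangle$-propagated, and (when $n>0$) $\Lambda$ is $n$-choice consistent. Algorithm $\mathtt{Prove_n}(\mathcal{R},\Gamma)$, steps tried in order: 1. If $w:p$ and $w:\overline{p}$ are both present, return true. 2. If the sequent is stable, return false. 3. If some $w$ is not saturated: (i) if $w:\phi\vee\psi$ is present but $w:\phi$ or $w:\psi$ absent, return $\mathtt{Prove_n}(\mathcal{R},w:\phi,w:\psi,\Gamma)$; (ii) if $w:\phi\wedge\psi$ is present but neither $w:\phi$ nor $w:\psi$, return false if $\mathtt{Prove_n}(\mathcal{R},w:\phi,\Gamma)$ or $\mathtt{Prove_n}(\mathcal{R},w:\psi,\Gamma)$ returns false, else true. 4. If some $w:\langle1\rangle\phi$ is present and some $u\in CT(w)$ has $u:\phi$ absent, return $\mathtt{Prove_n}(\mathcal{R},u:\phi,\Gamma)$. 5. If some $w:\Diamond\phi$ is present and some label $u$ has $u:\phi$ absent, return $\mathtt{Prove_n}(\mathcal{R},u:\phi,\Gamma)$. 6. If some $w:[1]\phi$ is present with $u:\phi$ absent for all $u\in CT(w)$, return $\mathtt{Prove_n}(\mathcal{R},\mathcal{R}_1wv,v:\phi,\Gamma)$, $v$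 fresh. 7. If some $w:\Box\phi$ is present with $u:\phi$ absent for all labels $u$, return $\mathtt{Prove_n}(\mathcal{R},v:\phi,\Gamma)$, $v$ fresh. 8. (Only when $n>0$.) If not $n$-choice consistent, pick distinct choice-tree roots $w_0,\dots,w_n$ and return false if $\mathtt{Prove_n}(\mathcal{R},\mathcal{R}_1w_kw_j,\Gamma)$ returns false for some $0\le k\le n-1$, $k+1\le j\le n$, else true. For $n=0$ step 8 is absent and stability omits $n$-choice consistency. -}

module Defs where

open import Data.Bool.Base using (Bool; true; false)
open import Data.List.Base using (List; []; _∷_; _++_; map; concatMap; length)
open import Data.List.Membership.Propositional using (_∈_; _∉_)
open import Data.List.Relation.Unary.All using (All)
open import Data.List.Relation.Unary.Any using (Any)
open import Data.List.Relation.Unary.Unique.Propositional using (Unique)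
open import Data.Nat.Base using (ℕ; suc; _≤_; _<_; _>_)
open import Data.Product using (∃; ∃-syntax; ∃!; _×_; _,_; proj₁)
open import Data.Sum.Base using (_⊎_)
open import Relation.Binary.Construct.Closure.Equivalence using (EqClosure)
open import Relation.Binary.PropositionalEquality using (_≡_)
open import Relation.Nullary using (¬_)

Atom Label : Set
Atom  = ℕ
Label = ℕ

infixr 7 _∧_
infixr 6 _∨_
infix  8 □_ ◇_ [1]_ ⟨1⟩_

data Formula : Set where
  atom natom      : Atom → Formula
  _∧_ _∨_         : Formula → Formula → Formula
  □_ ◇_ [1]_ ⟨1⟩_ : Formula → Formula

neg : Formula → Formula
neg (atom p)  = natom p
neg (natom p) = atom p
neg (φ ∧ ψ)   = neg φ ∨ neg ψ
neg (φ ∨ ψ)   = neg φ ∧ neg ψ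
neg (□ φ)     = ◇ neg φ
neg (◇ φ)     = □ neg φ
neg ([1] φ)   = ⟨1⟩ neg φ
neg (⟨1⟩ φ)   = [1] neg φ

-- The lists stand for multisets: everything below depends on a sequent only
-- through membership.
record Sequent : Set where
  constructor _∣_
  field
    relations : List (Label × Label)
    formulas  : List (Label × Formula)

open Sequent public

infix 4 _∋_∶_ _∌_∶_

_∋_∶_ _∌_∶_ : Sequent → Label → Formula → Set
Λ ∋ w ∶ φ = (w , φ) ∈ formulas Λ
Λ ∌ w ∶ φ = (w , φ) ∉ formulas Λ

infixl 5 _⊕_∶_ _⊕R_∙_

_⊕_∶_ : Sequent → Label → Formula → Sequent
(R ∣ Γ) ⊕ w ∶ φ = R ∣ ((w , φ) ∷ Γ)

_⊕R_∙_ : Sequent → Label → Label → Sequent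
(R ∣ Γ) ⊕R x ∙ y = ((x , y) ∷ R) ∣ Γ

labels : Sequent → List Label
labels (R ∣ Γ) = concatMap (λ (x , y) → x ∷ y ∷ []) R ++ map proj₁ Γ

Edge : Sequent → Label → Label → Set
Edge Λ x y = (x , y) ∈ relations Λ

-- Directed paths, indexed by the vertices visited after x, latest first.  Paths
-- are compared by this list, so repeated copies of an atom do not create new
-- paths.
data Path (Λ : Sequent) (x : Label) : List Label → Label → Set where
  stop : Path Λ x [] x
  step : ∀ {vs y z} → Path Λ x vs y → Edge Λ y z → Path Λ x (z ∷ vs) z

-- u ∈CT[ Λ ] w : u lies in CT(w).  The trees whose disjoint union is a forest
-- are its connected components.
_∈CT[_]_ : Label → Sequent → Label → Set
u ∈CT[ Λ ] w = EqClosure (Edge Λ) w u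

-- r is the root of its choice-tree.  Taking u = r as well excludes cycles
-- through r, in particular a loop on a one-vertex component.
Root : Sequent → Label → Set
Root Λ r = r ∈ labels Λ × (∀ u → u ∈CT[ Λ ] r → ∃! _≡_ λ vs → Path Λ r vs u)

record Saturated (Λ : Sequent) (w : Label) : Set where
  field
    consistent : ∀ φ → Λ ∋ w ∶ φ → Λ ∌ w ∶ neg φ
    ∨-closed   : ∀ φ ψ → Λ ∋ w ∶ φ ∨ ψ → Λ ∋ w ∶ φ × Λ ∋ w ∶ ψ
    ∧-closed   : ∀ φ ψ → Λ ∋ w ∶ φ ∧ ψ → Λ ∋ w ∶ φ ⊎ Λ ∋ w ∶ ψ

□-Realized [1]-Realized ◇-Propagated ⟨1⟩-Propagated : Sequent → Label → Set
□-Realized     Λ w = ∀ φ → Λ ∋ w ∶ □ φ   → ∃[ u ] (u ∈ labels Λ × Λ ∋ u ∶ φ)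
[1]-Realized   Λ w = ∀ φ → Λ ∋ w ∶ [1] φ → ∃[ u ] (u ∈CT[ Λ ] w × Λ ∋ u ∶ φ)
◇-Propagated   Λ w = ∀ φ → Λ ∋ w ∶ ◇ φ   → ∀ u → u ∈ labels Λ → Λ ∋ u ∶ φ
⟨1⟩-Propagated Λ w = ∀ φ → Λ ∋ w ∶ ⟨1⟩ φ → ∀ u → u ∈CT[ Λ ] w → Λ ∋ u ∶ φ

-- At most n choice-trees: some n (or fewer) labels meet all of them.
ChoiceConsistent : ℕ → Sequent → Set
ChoiceConsistent n Λ =
  ∃[ ts ] (length ts ≤ n × (∀ w → w ∈ labels Λ → Any (λ t → w ∈CT[ Λ ] t) ts))

record Stable (n : ℕ) (Λ : Sequent) : Set where
  field
    saturated         : ∀ w → w ∈ labels Λ → Saturated Λ w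
    □-realized        : ∀ w → w ∈ labels Λ → □-Realized Λ w
    [1]-realized      : ∀ w → w ∈ labels Λ → [1]-Realized Λ w
    ◇-propagated      : ∀ w → w ∈ labels Λ → ◇-Propagated Λ w
    ⟨1⟩-propagated    : ∀ w → w ∈ labels Λ → ⟨1⟩-Propagated Λ w
    choice-consistent : n > 0 → ChoiceConsistent n Λ

-- The pairs (w k , w j) with k < j.
pairs : List Label → List (Label × Label)
pairs []       = []
pairs (w ∷ ws) = map (w ,_) ws ++ pairs ws

-- What one invocation does: return a value, or make the listed recursive calls
-- and return false if one of them returns false, else true.
data Outcome : Set where
  return : Bool → Outcome
  call   : List Sequent → Outcome

calls : Outcome → List Sequent
calls (return _) = []
calls (call Λs)  = Λs

∨-Redex : Sequent → Label → Formula → Formula → Set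
∨-Redex Λ w φ ψ = Λ ∋ w ∶ φ ∨ ψ × (Λ ∌ w ∶ φ ⊎ Λ ∌ w ∶ ψ)

-- Step n k Λ o : clause number k of Prove_n, read without regard to the other
-- clauses, allows the input Λ to have outcome o.
data Step (n : ℕ) : ℕ → Sequent → Outcome → Set where

  closed : ∀ {Λ} w p → Λ ∋ w ∶ atom p → Λ ∋ w ∶ natom p →
           Step n 1 Λ (return true)

  stable : ∀ {Λ} → Stable n Λ →
           Step n 2 Λ (return false)

  ∨-step : ∀ {Λ} w φ ψ → w ∈ labels Λ → ¬ Saturated Λ w → ∨-Redex Λ w φ ψ →
           Step n 3 Λ (call ((Λ ⊕ w ∶ ψ ⊕ w ∶ φ) ∷ []))

  ∧-step : ∀ {Λ} w φ ψ → w ∈ labels Λ → ¬ Saturated Λ w →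
           (∀ χ θ → ¬ ∨-Redex Λ w χ θ) →
           Λ ∋ w ∶ φ ∧ ψ → Λ ∌ w ∶ φ → Λ ∌ w ∶ ψ →
           Step n 3 Λ (call ((Λ ⊕ w ∶ φ) ∷ (Λ ⊕ w ∶ ψ) ∷ []))

  ⟨1⟩-step : ∀ {Λ} w φ u → Λ ∋ w ∶ ⟨1⟩ φ → u ∈CT[ Λ ] w → Λ ∌ u ∶ φ →
             Step n 4 Λ (call ((Λ ⊕ u ∶ φ) ∷ []))

  ◇-step : ∀ {Λ} w φ u → Λ ∋ w ∶ ◇ φ → u ∈ labels Λ → Λ ∌ u ∶ φ →
           Step n 5 Λ (call ((Λ ⊕ u ∶ φ) ∷ []))

  [1]-step : ∀ {Λ} w φ v → Λ ∋ w ∶ [1] φ →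
             (∀ u → u ∈CT[ Λ ] w → Λ ∌ u ∶ φ) → v ∉ labels Λ →
             Step n 6 Λ (call ((Λ ⊕ v ∶ φ ⊕R w ∙ v) ∷ []))

  □-step : ∀ {Λ} w φ v → Λ ∋ w ∶ □ φ →
           (∀ u → u ∈ labels Λ → Λ ∌ u ∶ φ) → v ∉ labels Λ →
           Step n 7 Λ (call ((Λ ⊕ v ∶ φ) ∷ []))

  choice-step : ∀ {Λ} ws → n > 0 → ¬ ChoiceConsistent n Λ →
                length ws ≡ suc n → Unique ws → All (Root Λ) ws →
                Step n 8 Λ (call (map (λ (x , y) → Λ ⊕R x ∙ y) (pairs ws)))

-- Clauses are tried in order: clause k is used only if no earlier one applies.
Prove : ℕ → Sequent → Outcome → Set
Prove n Λ o = ∃[ k ] (Step n k Λ o × (∀ {j o′} → j < k → ¬ Step n j Λ o′))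

-- The computation on Λ terminates, however the choices left open by the
-- algorithm are made: it is not stuck, and every recursive call it may make
-- terminates.  Being inductive, this says that all call trees are well-founded.
data Terminates (n : ℕ) (Λ : Sequent) : Set where
  terminates : ∃ (Prove n Λ) →
               (∀ {o} → Prove n Λ o → All (Terminates n) (calls o)) →
               Terminates n Λ

initial : Label → Formula → Sequent
initial w φ = [] ∣ ((w , φ) ∷ [])

{-# OPTIONS --safe #-}
module Submission where

-- Only subformulas of φ occur, and a formula is put on a fresh label only if it is
-- missing from the whole sequent (□) or from the choice-tree (for [1]).  So □-steps
-- use up formulas, [1]-steps use up pairs of a tree and a formula, and step 8 merges
-- two trees into one that has no more missing formulas than either; all other calls
-- fill in labelled formulas.  These four counts decrease lexicographically.  The
-- algorithm is never stuck: when steps 1 and 3-7 do not apply, a clash would propagate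
-- down to one of atoms, so the sequent is stable or has more than n trees, and the
-- latter have roots because the graph remains a forest.

open import Defs
open import Data.List.Base
  using (List; []; _∷_; _++_; map; concatMap; length; filter; take; upTo;
         deduplicate; cartesianProduct)
open import Data.List.Membership.Propositional using (_∈_; _∉_; lose)
open import Data.List.Membership.Propositional.Properties
  using (∈-map⁺; ∈-map⁻; ∈-++⁺ˡ; ∈-++⁺ʳ; ∈-++⁻; ∈-concatMap⁺; ∈-filter⁺; ∈-filter⁻;
         ∈-cartesianProduct⁺; ∈-upTo⁺; ∈-∃++; ∈-deduplicate⁺; ∈-deduplicate⁻)
open import Data.List.Properties
  using (filter-++; filter-none; filter-accept; filter-reject; length-take;
         length-++; length-map; ++-conicalˡ)
open import Data.List.Relation.Binary.Sublist.Propositional.Properties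
  using (length-mono-≤) renaming (filter⁺ to filter-⊆)
open import Data.List.Relation.Binary.Sublist.Propositional using (⊆-refl)
open import Data.List.Relation.Binary.Subset.Propositional using (_⊆_)
open import Data.List.Relation.Unary.All as All using (All; []; _∷_)
import Data.List.Relation.Unary.All.Properties as All
open import Data.List.Relation.Unary.AllPairs using ([]; _∷_)
open import Data.List.Relation.Unary.Any as Any using (Any; here; there; any?; satisfied)
open import Data.List.Relation.Unary.Unique.Propositional using (Unique)
import Data.List.Relation.Unary.Unique.Propositional.Properties as Unique
import Data.List.Relation.Unary.Any.Properties as Any
open import Data.Nat.Base using (ℕ; zero; suc; _≤_; _<_; _>_; s≤s; z≤n)
open import Data.Nat.ListAction using (sum)
open import Data.Nat.Induction using (<-wellFounded)
open import Data.Nat.Properties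
  using (_≟_; _≤?_; _<?_; ≤-refl; ≤-trans; ≤-reflexive; <-≤-trans; m≤n⇒m≤1+n;
         ≰⇒>; ≤∧≢⇒<; m≤m+n; m≤n+m; +-suc; m≤n⇒m⊓n≡m; 1+n≰n)
open import Data.Product using (∃; ∃!; ∃-syntax; ∃₂; _×_; _,_; proj₁; proj₂; map₁; uncurry)
open import Data.Product.Properties using (≡-dec)
open import Data.Product.Relation.Binary.Lex.Strict using (×-Lex; ×-wellFounded')
open import Data.Sum.Base using (_⊎_; inj₁; inj₂; [_,_]′)
open import Function.Base using (_∘_; id)
open import Induction.WellFounded using (WellFounded; Acc; acc)
open import Relation.Binary.Construct.Closure.Equivalence
  using (gfold) renaming (symmetric to EqClosure-sym)
open import Relation.Binary.Construct.Closure.ReflexiveTransitive using (ε; _◅_; _◅◅_)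
open import Relation.Binary.Construct.Closure.Symmetric using (fwd)
open import Relation.Binary.Definitions using (DecidableEquality)
open import Relation.Binary.PropositionalEquality
  using (_≡_; _≢_; refl; sym; trans; cong; cong₂; subst; isEquivalence)
open import Relation.Nullary using (¬_; Dec; yes; no; contradiction)
open import Relation.Nullary.Decidable
  using (True; toWitness; map′; _×-dec_; _⊎-dec_; ¬?; decidable-stable)
open import Relation.Unary using (Decidable)

-- Search and counting in lists

∃-dec : {A : Set} {P : A → Set} (xs : List A) →
        (∀ {x} → P x → x ∈ xs) → Decidable P → Dec (∃ P)
∃-dec xs complete P? = map′ satisfied (λ (_ , p) → lose (complete p) p) (any? P? xs)

-- Passes from some applicable clause to the first applicable one, which is how `Prove` fixes the
-- order of the clauses.
least : {P : ℕ → Set} → Decidable P → ∀ {k} → P k → ∃[ m ] (P m × (∀ {j} → j < m → ¬ P j))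
least {P} P? {k} =
  -- The bound `suc k` puts `k` itself in the searched range, so an empty search contradicts `P k`.
  [ (λ none Pk → contradiction Pk (none ≤-refl)) , (λ found _ → found) ]′ (search (suc k))
  where
  search : ∀ b → (∀ {j} → j < b → ¬ P j) ⊎ (∃[ m ] (P m × (∀ {j} → j < m → ¬ P j)))
  search zero = inj₁ λ ()
  search (suc b) with search b
  ... | inj₂ found = inj₂ found
  ... | inj₁ none with P? b
  ...   | yes Pb = inj₂ (b , Pb , none)
  ...   | no ¬Pb = inj₁ below
    where
    below : ∀ {j} → j < suc b → ¬ P j
    below {j} (s≤s j≤b) with j ≟ b
    ... | yes refl = ¬Pb
    ... | no  j≢b  = none (≤∧≢⇒< j≤b j≢b)

fresh : ∀ xs → ∃[ v ] v ∉ xs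
fresh xs = suc (sum xs) , λ v∈ → 1+n≰n (∈⇒≤sum v∈)
  where
  ∈⇒≤sum : ∀ {x xs} → x ∈ xs → x ≤ sum xs
  ∈⇒≤sum {x} {_ ∷ xs} (here refl) = m≤m+n x (sum xs)
  ∈⇒≤sum {x} {y ∷ xs} (there x∈)  = ≤-trans (∈⇒≤sum x∈) (m≤n+m (sum xs) y)

-- Pigeonhole, by cutting the head of `xs` out of `ys`; by uniqueness the tail still embeds in what
-- is left. It will bound the number of roots.
Unique-⊆⇒length≤ : {A : Set} {xs ys : List A} → Unique xs → xs ⊆ ys → length xs ≤ length ys
Unique-⊆⇒length≤ [] _ = z≤n
Unique-⊆⇒length≤ {xs = x ∷ xs} (x∉xs ∷ unique) xs⊆ys with ∈-∃++ (xs⊆ys (here refl))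
... | as , bs , refl = ≤-trans (s≤s (Unique-⊆⇒length≤ unique rest)) (≤-reflexive length-insert)
  where
  rest : xs ⊆ as ++ bs
  rest z∈xs with ∈-++⁻ as (xs⊆ys (there z∈xs))
  ... | inj₁ z∈as         = ∈-++⁺ˡ z∈as
  ... | inj₂ (there z∈bs) = ∈-++⁺ʳ as z∈bs
  ... | inj₂ (here refl)  = contradiction refl (All.lookup x∉xs z∈xs)

  length-insert : suc (length (as ++ bs)) ≡ length (as ++ x ∷ bs)
  length-insert rewrite length-++ as {bs} | length-++ as {x ∷ bs} = sym (+-suc (length as) (length bs))

-- With `P` saying that a label is a root, this gives what each call of step 8 needs: an edge
-- between two different roots.
pairs⁺ : ∀ {P : Label → Set} {ws} → All P ws → Unique ws →
         All (λ (x , y) → P x × P y × x ≢ y) (pairs ws)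
pairs⁺ [] [] = []
pairs⁺ (px ∷ pxs) (x∉ ∷ unique) =
  All.++⁺ (All.map⁺ (All.zipWith (λ (py , x≢y) → px , py , x≢y) (pxs , x∉))) (pairs⁺ pxs unique)

module _ {A : Set} where

  #_ : {P : A → Set} → Decidable P → List A → ℕ
  (# P?) xs = length (filter P? xs)

  module _ {P Q : A → Set} (P? : Decidable P) (Q? : Decidable Q) (Q⇒P : ∀ {x} → Q x → P x) where

    #-mono : ∀ xs → (# Q?) xs ≤ (# P?) xs
    #-mono xs = length-mono-≤ (filter-⊆ Q? P? (λ { refl → Q⇒P }) (⊆-refl {x = xs}))

    #-strict : ∀ {x xs} → x ∈ xs → P x → ¬ Q x → (# Q?) xs < (# P?) xs
    #-strict {x} {xs = x ∷ xs} (here refl) p ¬q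
      rewrite filter-accept P? {x} {xs} p | filter-reject Q? {x} {xs} ¬q = s≤s (#-mono xs)
    #-strict {xs = y ∷ xs} (there x∈) p ¬q with Q? y | P? y
    ... | yes _ | yes _ = s≤s (#-strict x∈ p ¬q)
    ... | yes q | no ¬p = contradiction (Q⇒P q) ¬p
    ... | no  _ | yes _ = m≤n⇒m≤1+n (#-strict x∈ p ¬q)
    ... | no  _ | no  _ = #-strict x∈ p ¬q

-- Formulas

-- Decidable equality of formulas is pulled back from a type with two
-- constructors, so that the 64 pairs of constructors need not be compared.
private
  data Code : Set where
    leaf : ℕ → Code
    node : Code → Code → Code

  _≟ᶜ_ : DecidableEquality Code
  leaf m   ≟ᶜ leaf n     = map′ (cong leaf) (λ { refl → refl }) (m ≟ n)
  leaf _   ≟ᶜ node _ _   = no λ ()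
  node _ _ ≟ᶜ leaf _     = no λ ()
  node a b ≟ᶜ node a′ b′ =
    map′ (λ (p , q) → cong₂ node p q) (λ { refl → refl , refl }) (a ≟ᶜ a′ ×-dec b ≟ᶜ b′)

  encode : Formula → Code
  encode (atom p)  = node (leaf 0) (leaf p)
  encode (natom p) = node (leaf 1) (leaf p)
  encode (φ ∧ ψ)   = node (leaf 2) (node (encode φ) (encode ψ))
  encode (φ ∨ ψ)   = node (leaf 3) (node (encode φ) (encode ψ))
  encode (□ φ)     = node (leaf 4) (encode φ)
  encode (◇ φ)     = node (leaf 5) (encode φ)
  encode ([1] φ)   = node (leaf 6) (encode φ)
  encode (⟨1⟩ φ)   = node (leaf 7) (encode φ)

  decode : Code → Formula
  decode (node (leaf 0) (leaf p))   = atom p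
  decode (node (leaf 1) (leaf p))   = natom p
  decode (node (leaf 2) (node a b)) = decode a ∧ decode b
  decode (node (leaf 3) (node a b)) = decode a ∨ decode b
  decode (node (leaf 4) a)          = □ decode a
  decode (node (leaf 5) a)          = ◇ decode a
  decode (node (leaf 6) a)          = [1] decode a
  decode (node (leaf 7) a)          = ⟨1⟩ decode a
  decode _                          = atom 0

  decode-encode : ∀ φ → decode (encode φ) ≡ φ
  decode-encode (atom p)  = refl
  decode-encode (natom p) = refl
  decode-encode (φ ∧ ψ)   = cong₂ _∧_ (decode-encode φ) (decode-encode ψ)
  decode-encode (φ ∨ ψ)   = cong₂ _∨_ (decode-encode φ) (decode-encode ψ)
  decode-encode (□ φ)     = cong □_ (decode-encode φ)
  decode-encode (◇ φ)     = cong ◇_ (decode-encode φ)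
  decode-encode ([1] φ)   = cong [1]_ (decode-encode φ)
  decode-encode (⟨1⟩ φ)   = cong ⟨1⟩_ (decode-encode φ)

_≟ᶠ_ : DecidableEquality Formula
φ ≟ᶠ ψ = map′ (λ eq → trans (sym (decode-encode φ)) (trans (cong decode eq) (decode-encode ψ)))
              (cong encode) (encode φ ≟ᶜ encode ψ)

open import Data.List.Relation.Unary.Unique.DecPropositional.Properties _≟_ using (deduplicate-!)
open import Data.List.Membership.DecPropositional _≟_ using () renaming (_∈?_ to _∈ˡ?_)
open import Data.List.Membership.DecPropositional _≟ᶠ_ using () renaming (_∈?_ to _∈ᶠ?_)
open import Data.List.Membership.DecPropositional (≡-dec _≟_ _≟ᶠ_) using (_∈?_)

-- Proper subformulas are split off so that immediate components sit at known positions and closure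
-- of a set under parts is a single implication.
subformulas : Formula → List Formula
properSubformulas : Formula → List Formula

subformulas φ = φ ∷ properSubformulas φ

properSubformulas (atom _)  = []
properSubformulas (natom _) = []
properSubformulas (φ ∧ ψ)   = subformulas φ ++ subformulas ψ
properSubformulas (φ ∨ ψ)   = subformulas φ ++ subformulas ψ
properSubformulas (□ φ)     = subformulas φ
properSubformulas (◇ φ)     = subformulas φ
properSubformulas ([1] φ)   = subformulas φ
properSubformulas (⟨1⟩ φ)   = subformulas φ

subformulas-trans : ∀ φ {ψ χ} → ψ ∈ subformulas φ → χ ∈ properSubformulas ψ → χ ∈ subformulas φ
proper-trans : ∀ φ {ψ χ} → ψ ∈ properSubformulas φ → χ ∈ properSubformulas ψ →
               χ ∈ properSubformulas φ

subformulas-trans φ (here refl) χ∈ = there χ∈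
subformulas-trans φ (there ψ∈)  χ∈ = there (proper-trans φ ψ∈ χ∈)

proper-trans (φ ∧ ψ) ∈φψ χ∈ with ∈-++⁻ (subformulas φ) ∈φψ
... | inj₁ ∈φ = ∈-++⁺ˡ (subformulas-trans φ ∈φ χ∈)
... | inj₂ ∈ψ = ∈-++⁺ʳ (subformulas φ) (subformulas-trans ψ ∈ψ χ∈)
proper-trans (φ ∨ ψ) ∈φψ χ∈ with ∈-++⁻ (subformulas φ) ∈φψ
... | inj₁ ∈φ = ∈-++⁺ˡ (subformulas-trans φ ∈φ χ∈)
... | inj₂ ∈ψ = ∈-++⁺ʳ (subformulas φ) (subformulas-trans ψ ∈ψ χ∈)
proper-trans (□ φ)   = subformulas-trans φ
proper-trans (◇ φ)   = subformulas-trans φ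
proper-trans ([1] φ) = subformulas-trans φ
proper-trans (⟨1⟩ φ) = subformulas-trans φ

-- Forests

∋⇒label : ∀ {Λ w φ} → Λ ∋ w ∶ φ → w ∈ labels Λ
∋⇒label {Λ} w∶φ = ∈-++⁺ʳ (concatMap _ (relations Λ)) (∈-map⁺ proj₁ w∶φ)

edge⇒labels : ∀ {Λ x y} → Edge Λ x y → x ∈ labels Λ × y ∈ labels Λ
edge⇒labels {Λ} e = ∈-++⁺ˡ (∈-concatMap⁺ _ (lose e (here refl)))
                  , ∈-++⁺ˡ (∈-concatMap⁺ _ (lose e (there (here refl))))

module _ {Λ : Sequent} where

  _⊕ᵖ_ : ∀ {x y z us vs} → Path Λ x us y → Path Λ y vs z → Path Λ x (vs ++ us) z
  p ⊕ᵖ stop     = p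
  p ⊕ᵖ step q e = step (p ⊕ᵖ q) e

  path⇒CT : ∀ {x vs y} → Path Λ x vs y → y ∈CT[ Λ ] x
  path⇒CT stop       = ε
  path⇒CT (step p e) = path⇒CT p ◅◅ fwd e ◅ ε

  source-label : ∀ {x vs y} → Path Λ x vs y → y ∈ labels Λ → x ∈ labels Λ
  source-label stop       y∈ = y∈
  source-label (step p e) _  = source-label p (proj₁ (edge⇒labels {Λ} e))

  target-label : ∀ {x vs y} → Path Λ x vs y → x ∈ labels Λ → y ∈ labels Λ
  target-label stop       x∈ = x∈
  target-label (step p e) _  = proj₂ (edge⇒labels {Λ} e)

  path-to-nonlabel : ∀ {x vs y} → Path Λ x vs y → y ∉ labels Λ → x ≡ y
  path-to-nonlabel stop       _  = refl
  path-to-nonlabel (step p e) y∉ = contradiction (proj₂ (edge⇒labels {Λ} e)) y∉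

Path-⊆ : ∀ {Λ Λ′ x vs y} → relations Λ ⊆ relations Λ′ → Path Λ x vs y → Path Λ′ x vs y
Path-⊆ Λ⊆ stop       = stop
Path-⊆ Λ⊆ (step p e) = step (Path-⊆ Λ⊆ p) (Λ⊆ e)

-- All natural numbers are vertices here; those that are not labels are
-- one-vertex trees, so that a fresh label does not change the forest.
record Forest (Λ : Sequent) : Set where
  field
    root      : Label → Label
    root-edge : ∀ {x y} → Edge Λ x y → root x ≡ root y
    root-path : ∀ u → ∃! _≡_ λ vs → Path Λ (root u) vs u

  path-from-root : ∀ u → Path Λ (root u) (proj₁ (root-path u)) u
  path-from-root u = proj₁ (proj₂ (root-path u))

  root-CT : ∀ {u w} → u ∈CT[ Λ ] w → root w ≡ root u
  root-CT = gfold isEquivalence root root-edge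

  CT-root : ∀ {u} → u ∈CT[ Λ ] root u
  CT-root {u} = path⇒CT (path-from-root u)

  root≡⇒CT : ∀ {u w} → root w ≡ root u → u ∈CT[ Λ ] w
  root≡⇒CT {u} {w} eq =
    EqClosure-sym (Edge Λ) CT-root ◅◅ subst (λ r → u ∈CT[ Λ ] r) (sym eq) CT-root

  root-idem : ∀ u → root (root u) ≡ root u
  root-idem u = root-CT CT-root

  root-label : ∀ {u} → u ∈ labels Λ → root u ∈ labels Λ
  root-label {u} = source-label (path-from-root u)

  root-nonlabel : ∀ {u} → u ∉ labels Λ → root u ≡ u
  root-nonlabel {u} = path-to-nonlabel (path-from-root u)

  -- The argument runs through the common root: it is a label because a path leads from it to `w`,
  -- and then so is every vertex that it reaches.
  CT-label : ∀ {u w} → w ∈ labels Λ → u ∈CT[ Λ ] w → u ∈ labels Λ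
  CT-label {u} w∈ u∈CT =
    target-label (path-from-root u)
                 (subst (_∈ labels Λ) (root-CT u∈CT) (root-label w∈))

  CT? : ∀ u w → Dec (u ∈CT[ Λ ] w)
  CT? u w = map′ root≡⇒CT root-CT (root w ≟ root u)

  -- Going from `r` to `root r` and back is a path from `r` to itself. Uniqueness of such paths
  -- makes it empty, and with it the path from `root r` to `r`.
  Root⇒fixed : ∀ {r} → Root Λ r → root r ≡ r
  Root⇒fixed {r} (_ , paths) =
    stop-only p (++-conicalˡ _ _ (sym (trans (sym (unique stop)) (unique (q ⊕ᵖ p)))))
    where
    p : Path Λ (root r) _ r
    p = path-from-root r
    q : Path Λ r _ (root r)
    q = proj₁ (proj₂ (paths (root r) (EqClosure-sym (Edge Λ) CT-root)))
    unique : ∀ {vs} → Path Λ r vs r → _ ≡ vs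
    unique = proj₂ (proj₂ (paths r ε))
    stop-only : ∀ {x vs y} → Path Λ x vs y → vs ≡ [] → x ≡ y
    stop-only stop _ = refl

  fixed⇒Root : ∀ {r} → r ∈ labels Λ → root r ≡ r → Root Λ r
  fixed⇒Root {r} r∈ fixed = r∈ , λ u u∈CT →
    subst (λ s → ∃! _≡_ λ vs → Path Λ s vs u) (trans (sym (root-CT u∈CT)) fixed) (root-path u)

-- Joining two trees by an edge

module _ {Λ : Sequent} (F : Forest Λ) where
  open Forest F

  Forest-relations : ∀ {Λ′} → relations Λ ≡ relations Λ′ → Forest Λ′
  Forest-relations {_ ∣ _} refl = record
    { root      = root
    ; root-edge = root-edge
    ; root-path = λ u → let vs , p , unique = root-path u in
                        vs , Path-⊆ id p , λ q → unique (Path-⊆ id q)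
    }

  -- Covers both ways in which edges arise: in step 8 both ends are roots; in the `[1]`-step `y` is
  -- a fresh label and hence a tree by itself.
  module Attach {x y : Label} (y-root : root y ≡ y) (x∉CTy : root x ≢ y) where

    private Λ′ = Λ ⊕R x ∙ y

    root′ : Label → Label
    root′ u with root u ≟ y
    ... | yes _ = root x
    ... | no  _ = root u

    root′-moved : ∀ {u} → root u ≡ y → root′ u ≡ root x
    root′-moved {u} eq with root u ≟ y
    ... | yes _  = refl
    ... | no  ne = contradiction eq ne

    root′-kept : ∀ {u} → root u ≢ y → root′ u ≡ root u
    root′-kept {u} ne with root u ≟ y
    ... | yes eq = contradiction eq ne
    ... | no  _  = refl

    -- If the tree of `u` had moved, `u` would be `root x`, which lies outside the tree of `y`. So
    -- attaching creates no root and removes `y`; the later counting of roots rests on this.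
    root′-fixed : ∀ {u} → root′ u ≡ u → root u ≡ u × u ≢ y
    root′-fixed {u} fixed with root u ≟ y
    ... | yes eq   = contradiction (trans (sym (trans (cong root (sym fixed)) (root-idem x))) eq) x∉CTy
    ... | no  ne   = fixed , λ u≡y → ne (trans fixed u≡y)

    root′-cong : ∀ {u v} → root u ≡ root v → root′ u ≡ root′ v
    root′-cong {u} {v} eq with root v ≟ y
    ... | yes eq′ = root′-moved (trans eq eq′)
    ... | no  ne  = trans (root′-kept (λ u≡ → ne (trans (sym eq) u≡))) eq

    -- Once a path has used the new edge it is in the tree of `y`, and old edges never leave a tree.
    old-path : ∀ {a vs u} → root u ≢ y → Path Λ′ a vs u → Path Λ a vs u
    old-path _  stop                  = stop
    old-path ne (step p (here refl))  = contradiction y-root ne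
    old-path ne (step p (there e))    = step (old-path (λ eq → ne (trans (sym (root-edge e)) eq)) p) e

    -- The only way into the tree of y is through the new edge.
    split-path : ∀ {vs u} → root u ≡ y → Path Λ′ (root x) vs u →
                 ∃₂ λ us ts → Path Λ y us u × Path Λ (root x) ts x × vs ≡ us ++ y ∷ ts
    split-path eq stop = contradiction (trans (sym (root-idem x)) eq) x∉CTy
    split-path eq (step p (here refl)) = [] , _ , stop , old-path x∉CTy p , refl
    split-path eq (step p (there e))
      with us , ts , q , r , refl ← split-path (trans (root-edge e) eq) p
      = _ ∷ us , ts , step q e , r , refl

    root′-path : ∀ u → ∃! _≡_ λ vs → Path Λ′ (root′ u) vs u
    root′-path u with root u ≟ y
    ... | no  ne = let vs , p , unique = root-path u in
                   vs , Path-⊆ there p , λ q → unique (old-path ne q)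
    -- Here `y` is `root u`. The path is the old one to `x`, the new edge, then the old one from
    -- `y`; it is unique because both old pieces are.
    ... | yes refl = let us , p , uniqueᵤ = root-path u
                         ts , q , uniqueₓ = root-path x in
                   us ++ y ∷ ts
                   , (step (Path-⊆ there q) (here refl) ⊕ᵖ Path-⊆ there p)
                   , λ r → let _ , _ , p′ , q′ , eq = split-path refl r in
                           trans (cong₂ (λ us ts → us ++ y ∷ ts) (uniqueᵤ p′) (uniqueₓ q′)) (sym eq)

    attach : Forest Λ′
    attach = record
      { root      = root′
      ; root-edge = λ { (here refl) → trans (root′-kept x∉CTy) (sym (root′-moved y-root))
                      ; (there e)   → root′-cong (root-edge e) }
      ; root-path = root′-path
      }

-- Every sequent has an applicable clause

module Progress (n : ℕ) {S : List Formula}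
                (S-closed : ∀ {φ χ} → φ ∈ S → χ ∈ properSubformulas φ → χ ∈ S)
                {Λ : Sequent} (known : ∀ {w φ} → Λ ∋ w ∶ φ → φ ∈ S) (F : Forest Λ) where
  open Forest F

  Applies : ℕ → Set
  Applies k = ∃ (Step n k Λ)

  private
    part : ∀ {w φ χ} → Λ ∋ w ∶ φ → χ ∈ properSubformulas φ → χ ∈ S
    part w∶φ = S-closed (known w∶φ)

    _∶?_ : ∀ w φ → Dec (Λ ∋ w ∶ φ)
    w ∶? φ = (w , φ) ∈? formulas Λ

    label : ∀ {w φ} → Λ ∋ w ∶ φ → w ∈ labels Λ
    label = ∋⇒label {Λ}

    -- Turns `S` into a list of candidate atoms. The default 0 merely adds a candidate, which the
    -- search then tests.
    atomOf : Formula → Atom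
    atomOf (atom p) = p
    atomOf _        = 0

  -- This and the following searches are finite: labels come from `labels Λ`, and formulas from `S`,
  -- which contains all parts of the formulas present.
  closed? : Dec (∃₂ λ w p → Λ ∋ w ∶ atom p × Λ ∋ w ∶ natom p)
  closed? =
    ∃-dec (labels Λ) (λ (_ , w∶p , _) → label w∶p) λ w →
    ∃-dec (map atomOf S) (λ (w∶p , _) → ∈-map⁺ atomOf (known w∶p)) λ p →
    (w ∶? atom p) ×-dec (w ∶? natom p)

  ∨-redex? : Dec (∃[ w ] ∃₂ (∨-Redex Λ w))
  ∨-redex? =
    ∃-dec (labels Λ) (λ (_ , _ , w∶ , _) → label w∶) λ w →
    ∃-dec S (λ (_ , w∶ , _) → part w∶ (here refl)) λ φ →
    ∃-dec S (λ (w∶ , _) → part w∶ (∈-++⁺ʳ (subformulas φ) (here refl))) λ ψ →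
    (w ∶? (φ ∨ ψ)) ×-dec (¬? (w ∶? φ) ⊎-dec ¬? (w ∶? ψ))

  ∧-redex? : Dec (∃[ w ] ∃₂ λ φ ψ → Λ ∋ w ∶ φ ∧ ψ × Λ ∌ w ∶ φ × Λ ∌ w ∶ ψ)
  ∧-redex? =
    ∃-dec (labels Λ) (λ (_ , _ , w∶ , _) → label w∶) λ w →
    ∃-dec S (λ (_ , w∶ , _) → part w∶ (here refl)) λ φ →
    ∃-dec S (λ (w∶ , _) → part w∶ (∈-++⁺ʳ (subformulas φ) (here refl))) λ ψ →
    (w ∶? (φ ∧ ψ)) ×-dec (¬? (w ∶? φ) ×-dec ¬? (w ∶? ψ))

  ⟨1⟩-redex? : Dec (∃₂ λ w φ → ∃[ u ] (Λ ∋ w ∶ ⟨1⟩ φ × u ∈CT[ Λ ] w × Λ ∌ u ∶ φ))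
  ⟨1⟩-redex? =
    ∃-dec (labels Λ) (λ (_ , _ , w∶ , _) → label w∶) λ w →
    ∃-dec S (λ (_ , w∶ , _) → part w∶ (here refl)) λ φ →
    ∃-dec (labels Λ) (λ (w∶ , u∈ , _) → CT-label (label w∶) u∈) λ u →
    (w ∶? (⟨1⟩ φ)) ×-dec CT? u w ×-dec ¬? (u ∶? φ)

  ◇-redex? : Dec (∃₂ λ w φ → ∃[ u ] (Λ ∋ w ∶ ◇ φ × u ∈ labels Λ × Λ ∌ u ∶ φ))
  ◇-redex? =
    ∃-dec (labels Λ) (λ (_ , _ , w∶ , _) → label w∶) λ w →
    ∃-dec S (λ (_ , w∶ , _) → part w∶ (here refl)) λ φ →
    ∃-dec (labels Λ) (λ (_ , u∈ , _) → u∈) λ u →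
    (w ∶? (◇ φ)) ×-dec (u ∈ˡ? labels Λ) ×-dec ¬? (u ∶? φ)

  [1]-realized? : ∀ w φ → Dec (∃[ u ] (u ∈CT[ Λ ] w × Λ ∋ u ∶ φ))
  [1]-realized? w φ = ∃-dec (labels Λ) (λ (_ , u∶φ) → label u∶φ) λ u → CT? u w ×-dec (u ∶? φ)

  □-realized? : ∀ φ → Dec (∃[ u ] (u ∈ labels Λ × Λ ∋ u ∶ φ))
  □-realized? φ = ∃-dec (labels Λ) proj₁ λ u → (u ∈ˡ? labels Λ) ×-dec (u ∶? φ)

  [1]-redex? : Dec (∃₂ λ w φ → Λ ∋ w ∶ [1] φ × ¬ (∃[ u ] (u ∈CT[ Λ ] w × Λ ∋ u ∶ φ)))
  [1]-redex? =
    ∃-dec (labels Λ) (λ (_ , w∶ , _) → label w∶) λ w →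
    ∃-dec S (λ (w∶ , _) → part w∶ (here refl)) λ φ →
    (w ∶? ([1] φ)) ×-dec ¬? ([1]-realized? w φ)

  □-redex? : Dec (∃₂ λ w φ → Λ ∋ w ∶ □ φ × ¬ (∃[ u ] (u ∈ labels Λ × Λ ∋ u ∶ φ)))
  □-redex? =
    ∃-dec (labels Λ) (λ (_ , w∶ , _) → label w∶) λ w →
    ∃-dec S (λ (w∶ , _) → part w∶ (here refl)) λ φ →
    (w ∶? (□ φ)) ×-dec ¬? (□-realized? φ)

  -- Counting choice-trees by their roots

  roots : List Label
  roots = deduplicate _≟_ (filter (λ r → root r ≟ r) (labels Λ))

  roots-unique : Unique roots
  roots-unique = deduplicate-! _

  ∈roots⁻ : ∀ {r} → r ∈ roots → r ∈ labels Λ × root r ≡ r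
  ∈roots⁻ r∈ = ∈-filter⁻ (λ r → root r ≟ r) (∈-deduplicate⁻ _≟_ _ r∈)

  ∈roots⁺ : ∀ {r} → r ∈ labels Λ → root r ≡ r → r ∈ roots
  ∈roots⁺ r∈ fixed = ∈-deduplicate⁺ _≟_ (∈-filter⁺ (λ r → root r ≟ r) r∈ fixed)

  -- Each root lies in the tree of some `t` in `ts` and so equals `root t`. Hence the distinct roots
  -- all occur in `map root ts`.
  choiceConsistent⇒ : ChoiceConsistent n Λ → length roots ≤ n
  choiceConsistent⇒ (ts , length≤ , meets) =
    ≤-trans (Unique-⊆⇒length≤ roots-unique roots⊆)
            (≤-trans (≤-reflexive (length-map root ts)) length≤)
    where
    roots⊆ : roots ⊆ map root ts
    roots⊆ r∈ with r∈Λ , fixed ← ∈roots⁻ r∈ =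
      Any.map⁺ (Any.map (λ r∈CT → trans (sym fixed) (sym (root-CT r∈CT))) (meets _ r∈Λ))

  choiceConsistent⇐ : length roots ≤ n → ChoiceConsistent n Λ
  choiceConsistent⇐ length≤ = roots , length≤ , λ w w∈ →
    lose (∈roots⁺ (root-label w∈) (root-idem w)) CT-root

  choiceConsistent? : Dec (ChoiceConsistent n Λ)
  choiceConsistent? = map′ choiceConsistent⇐ choiceConsistent⇒ (length roots ≤? n)

  ∨-redex⇒unsaturated : ∀ {w φ ψ} → ∨-Redex Λ w φ ψ → ¬ Saturated Λ w
  ∨-redex⇒unsaturated (w∶ , absent) sat with w∶φ , w∶ψ ← Saturated.∨-closed sat _ _ w∶ =
    [ contradiction w∶φ , contradiction w∶ψ ]′ absent

  apply-∨ : ∀ {w φ ψ} → ∨-Redex Λ w φ ψ → Applies 3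
  apply-∨ redex = _ , ∨-step _ _ _ (label (proj₁ redex)) (∨-redex⇒unsaturated redex) redex

  apply-∧ : ∀ {w φ ψ} → (∀ χ θ → ¬ ∨-Redex Λ w χ θ) →
            Λ ∋ w ∶ φ ∧ ψ → Λ ∌ w ∶ φ → Λ ∌ w ∶ ψ → Applies 3
  apply-∧ no-∨ w∶ w∌φ w∌ψ =
    _ , ∧-step _ _ _ (label w∶) (λ sat → [ w∌φ , w∌ψ ]′ (Saturated.∧-closed sat _ _ w∶))
          no-∨ w∶ w∌φ w∌ψ

  apply-[1] : ∀ {w φ} → Λ ∋ w ∶ [1] φ → ¬ (∃[ u ] (u ∈CT[ Λ ] w × Λ ∋ u ∶ φ)) → Applies 6
  apply-[1] w∶ none = let v , v∉ = fresh (labels Λ) in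
    _ , [1]-step _ _ v w∶ (λ u u∈ u∶ → none (u , u∈ , u∶)) v∉

  apply-□ : ∀ {w φ} → Λ ∋ w ∶ □ φ → ¬ (∃[ u ] (u ∈ labels Λ × Λ ∋ u ∶ φ)) → Applies 7
  apply-□ w∶ none = let v , v∉ = fresh (labels Λ) in
    _ , □-step _ _ v w∶ (λ u u∈ u∶ → none (u , u∈ , u∶)) v∉

  apply-choice : n > 0 → ¬ ChoiceConsistent n Λ → Applies 8
  apply-choice n>0 ¬cc =
    -- Inconsistency leaves more than `n` roots, so this prefix has exactly `suc n` elements.
    _ , choice-step (take (suc n) roots) n>0 ¬cc
          (trans (length-take (suc n) roots) (m≤n⇒m⊓n≡m (≰⇒> (¬cc ∘ choiceConsistent⇐))))
          (Unique.take⁺ (suc n) roots-unique)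
          (All.take⁺ (suc n) (All.tabulate (uncurry fixed⇒Root ∘ ∈roots⁻)))

  -- Clause 2 is set apart because `Stable` quantifies over all formulas. It is settled afterwards:
  -- it holds exactly when no other clause applies.
  otherThan2? : ∀ k → k ≢ 2 → Dec (Applies k)
  otherThan2? 0 _ = no λ ()
  otherThan2? 1 _ = map′ (λ (w , p , w∶p , w∶p̄) → _ , closed w p w∶p w∶p̄)
                         (λ { (_ , closed w p w∶p w∶p̄) → w , p , w∶p , w∶p̄ }) closed?
  otherThan2? 2 ne = contradiction refl ne
  otherThan2? 3 _ with ∨-redex?
  ... | yes (_ , _ , _ , redex) = yes (apply-∨ redex)
  -- With no disjunction left to expand at any label, the side condition of `∧-step` holds
  -- automatically.
  ... | no no-∨ = map′
    (λ (_ , _ , _ , w∶ , w∌φ , w∌ψ) → apply-∧ (λ χ θ redex → no-∨ (_ , χ , θ , redex)) w∶ w∌φ w∌ψ)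
    (λ { (_ , ∨-step w φ ψ _ _ redex)         → contradiction (w , φ , ψ , redex) no-∨
       ; (_ , ∧-step w φ ψ _ _ _ w∶ w∌φ w∌ψ) → w , φ , ψ , w∶ , w∌φ , w∌ψ }) ∧-redex?
  otherThan2? 4 _ = map′ (λ (w , φ , u , w∶ , u∈ , u∌) → _ , ⟨1⟩-step w φ u w∶ u∈ u∌)
                         (λ { (_ , ⟨1⟩-step w φ u w∶ u∈ u∌) → w , φ , u , w∶ , u∈ , u∌ }) ⟨1⟩-redex?
  otherThan2? 5 _ = map′ (λ (w , φ , u , w∶ , u∈ , u∌) → _ , ◇-step w φ u w∶ u∈ u∌)
                         (λ { (_ , ◇-step w φ u w∶ u∈ u∌) → w , φ , u , w∶ , u∈ , u∌ }) ◇-redex?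
  otherThan2? 6 _ = map′
    (λ (_ , _ , w∶ , none) → apply-[1] w∶ none)
    (λ { (_ , [1]-step w φ v w∶ none _) → w , φ , w∶ , λ (u , u∈ , u∶) → none u u∈ u∶ }) [1]-redex?
  otherThan2? 7 _ = map′
    (λ (_ , _ , w∶ , none) → apply-□ w∶ none)
    (λ { (_ , □-step w φ v w∶ none _) → w , φ , w∶ , λ (u , u∈ , u∶) → none u u∈ u∶ }) □-redex?
  otherThan2? 8 _ = map′ (uncurry apply-choice) (λ { (_ , choice-step _ n>0 ¬cc _ _ _) → n>0 , ¬cc })
                         ((0 <? n) ×-dec ¬? choiceConsistent?)
  otherThan2? (suc (suc (suc (suc (suc (suc (suc (suc (suc _))))))))) _ = no λ ()

  Applies⇒<9 : ∀ {k} → Applies k → k < 9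
  Applies⇒<9 {k} (_ , s) = toWitness {a? = k <? 9} (bound s)
    where
    bound : ∀ {k o} → Step n k Λ o → True (k <? 9)
    bound (closed _ _ _ _)           = _
    bound (stable _)                 = _
    bound (∨-step _ _ _ _ _ _)       = _
    bound (∧-step _ _ _ _ _ _ _ _ _) = _
    bound (⟨1⟩-step _ _ _ _ _ _)     = _
    bound (◇-step _ _ _ _ _ _)       = _
    bound ([1]-step _ _ _ _ _ _)     = _
    bound (□-step _ _ _ _ _ _)       = _
    bound (choice-step _ _ _ _ _ _)  = _

  -- The premises of every other clause contradict one component of stability.
  otherThan2⇒¬Stable : ∀ {k} → k ≢ 2 → Applies k → ¬ Stable n Λ
  otherThan2⇒¬Stable ne (_ , s) st = refute ne s
    where
    open Stable st
    refute : ∀ {k o} → k ≢ 2 → ¬ Step n k Λ o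
    refute _ (closed w p w∶p w∶p̄) =
      Saturated.consistent (saturated w (label w∶p)) (atom p) w∶p w∶p̄
    refute ne (stable _)                   = ne refl
    refute _ (∨-step w _ _ w∈ unsat _)       = unsat (saturated w w∈)
    refute _ (∧-step w _ _ w∈ unsat _ _ _ _) = unsat (saturated w w∈)
    refute _ (⟨1⟩-step w φ u w∶ u∈ u∌)       = u∌ (⟨1⟩-propagated w (label w∶) φ w∶ u u∈)
    refute _ (◇-step w φ u w∶ u∈ u∌)         = u∌ (◇-propagated w (label w∶) φ w∶ u u∈)
    refute _ ([1]-step w φ _ w∶ none _) =
      let u , u∈ , u∶ = [1]-realized w (label w∶) φ w∶ in none u u∈ u∶
    refute _ (□-step w φ _ w∶ none _) =
      let u , u∈ , u∶ = □-realized w (label w∶) φ w∶ in none u u∈ u∶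
    refute _ (choice-step _ n>0 ¬cc _ _ _)   = ¬cc (choice-consistent n>0)

  module _ (idle : ∀ {k} → k ≢ 2 → ¬ Applies k) where

    private
      present : ∀ {w φ} → ¬ Λ ∌ w ∶ φ → Λ ∋ w ∶ φ
      present {w} {φ} = decidable-stable (w ∶? φ)

      no-∨-redex : ∀ {w} φ ψ → ¬ ∨-Redex Λ w φ ψ
      no-∨-redex _ _ redex = idle (λ ()) (apply-∨ redex)

      ∨⁻ : ∀ w φ ψ → Λ ∋ w ∶ φ ∨ ψ → Λ ∋ w ∶ φ × Λ ∋ w ∶ ψ
      ∨⁻ w φ ψ w∶ = present (λ w∌ → no-∨-redex φ ψ (w∶ , inj₁ w∌))
                  , present (λ w∌ → no-∨-redex φ ψ (w∶ , inj₂ w∌))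

      ∧⁻ : ∀ w φ ψ → Λ ∋ w ∶ φ ∧ ψ → Λ ∋ w ∶ φ ⊎ Λ ∋ w ∶ ψ
      ∧⁻ w φ ψ w∶ = decidable-stable ((w ∶? φ) ⊎-dec (w ∶? ψ)) λ neither →
        idle (λ ()) (apply-∧ no-∨-redex w∶ (neither ∘ inj₁) (neither ∘ inj₂))

      ⟨1⟩⁻ : ∀ w → ⟨1⟩-Propagated Λ w
      ⟨1⟩⁻ w φ w∶ u u∈ = present λ u∌ → idle (λ ()) (_ , ⟨1⟩-step w φ u w∶ u∈ u∌)

      ◇⁻ : ∀ w → ◇-Propagated Λ w
      ◇⁻ w φ w∶ u u∈ = present λ u∌ → idle (λ ()) (_ , ◇-step w φ u w∶ u∈ u∌)

      [1]⁻ : ∀ w → [1]-Realized Λ w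
      [1]⁻ w φ w∶ = decidable-stable ([1]-realized? w φ) λ none → idle (λ ()) (apply-[1] w∶ none)

      □⁻ : ∀ w → □-Realized Λ w
      □⁻ w φ w∶ = decidable-stable (□-realized? φ) λ none → idle (λ ()) (apply-□ w∶ none)

      -- A clash between complex formulas propagates down to one between atoms.
      consistent : ∀ {w} φ → Λ ∋ w ∶ φ → Λ ∌ w ∶ neg φ
      consistent {w} (atom p)  w∶p w∶p̄ = idle (λ ()) (_ , closed w p w∶p w∶p̄)
      consistent {w} (natom p) w∶p̄ w∶p = idle (λ ()) (_ , closed w p w∶p w∶p̄)
      consistent {w} (φ ∧ ψ) w∶ w∶¬ with w∶¬φ , w∶¬ψ ← ∨⁻ w _ _ w∶¬ =
        [ (λ w∶φ → consistent φ w∶φ w∶¬φ) , (λ w∶ψ → consistent ψ w∶ψ w∶¬ψ) ]′ (∧⁻ w φ ψ w∶)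
      consistent {w} (φ ∨ ψ) w∶ w∶¬ with w∶φ , w∶ψ ← ∨⁻ w φ ψ w∶ =
        [ consistent φ w∶φ , consistent ψ w∶ψ ]′ (∧⁻ w _ _ w∶¬)
      consistent {w} (□ φ) w∶ w∶¬ with u , u∈ , u∶φ ← □⁻ w φ w∶ =
        consistent φ u∶φ (◇⁻ w _ w∶¬ u u∈)
      consistent {w} (◇ φ) w∶ w∶¬ with u , u∈ , u∶¬φ ← □⁻ w _ w∶¬ =
        consistent φ (◇⁻ w φ w∶ u u∈) u∶¬φ
      consistent {w} ([1] φ) w∶ w∶¬ with u , u∈ , u∶φ ← [1]⁻ w φ w∶ =
        consistent φ u∶φ (⟨1⟩⁻ w _ w∶¬ u u∈)
      consistent {w} (⟨1⟩ φ) w∶ w∶¬ with u , u∈ , u∶¬φ ← [1]⁻ w _ w∶¬ =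
        consistent φ (⟨1⟩⁻ w φ w∶ u u∈) u∶¬φ

    idle⇒Stable : Stable n Λ
    idle⇒Stable = record
      { saturated         = λ w _ → record
          { consistent = consistent ; ∨-closed = ∨⁻ w ; ∧-closed = ∧⁻ w }
      ; □-realized        = λ w _ → □⁻ w
      ; [1]-realized      = λ w _ → [1]⁻ w
      ; ◇-propagated      = λ w _ → ◇⁻ w
      ; ⟨1⟩-propagated    = λ w _ → ⟨1⟩⁻ w
      ; choice-consistent = λ n>0 → decidable-stable choiceConsistent? λ ¬cc →
          idle (λ ()) (apply-choice n>0 ¬cc)
      }

  active? : Dec (∃[ k ] (k ≢ 2 × Applies k))
  active? = ∃-dec (upTo 9) (∈-upTo⁺ ∘ Applies⇒<9 ∘ proj₂) dec
    where
    dec : ∀ k → Dec (k ≢ 2 × Applies k)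
    dec k with k ≟ 2
    ... | yes eq = no λ (ne , _) → ne eq
    ... | no  ne = map′ (ne ,_) proj₂ (otherThan2? k ne)

  stable? : Dec (Stable n Λ)
  stable? with active?
  ... | yes (_ , ne , a) = no (otherThan2⇒¬Stable ne a)
  ... | no  inactive     = yes (idle⇒Stable λ ne a → inactive (_ , ne , a))

  applies? : Decidable Applies
  applies? k with k ≟ 2
  ... | no  ne   = otherThan2? k ne
  ... | yes refl = map′ (λ st → _ , stable st) (λ { (_ , stable st) → st }) stable?

  some-clause : ∃ Applies
  some-clause with active?
  ... | yes (k , _ , a) = k , a
  ... | no inactive     = 2 , _ , stable (idle⇒Stable λ ne a → inactive (_ , ne , a))

  progress : ∃ (Prove n Λ)
  progress with k , (o , s) , none ← least applies? (proj₂ some-clause) =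
    o , k , s , λ j<k s′ → none j<k (_ , s′)

-- Every call decreases a measure

infix 4 _≺_

-- Before the deciding component, earlier ones need only be weakly smaller, not equal. A call may
-- thus lower an earlier count incidentally without a case distinction.
_≺_ : (m m′ : ℕ × ℕ × ℕ × ℕ) → Set
_≺_ = ×-Lex _≤_ _<_ (×-Lex _≤_ _<_ (×-Lex _≤_ _<_ _<_))

≺-wellFounded : WellFounded _≺_
≺-wellFounded = lex (lex (lex <-wellFounded))
  where
  lex : {A : Set} {_⊏_ : A → A → Set} → WellFounded _⊏_ → WellFounded (×-Lex _≤_ _<_ _⊏_)
  lex = ×-wellFounded' ≤-trans (λ x≤y z<x → <-≤-trans z<x x≤y) <-wellFounded

module Descent (S : List Formula)
               (S-closed : ∀ {φ χ} → φ ∈ S → χ ∈ properSubformulas φ → χ ∈ S) where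

  -- `labels Λ` repeats a label at each occurrence, so counts over it would change with every added
  -- formula. `vertices` is a separate index list that grows only with a fresh label.
  record Invariant (Λ : Sequent) : Set where
    field
      forest   : Forest Λ
      vertices : List Label
      labels⊆  : labels Λ ⊆ vertices
      known    : ∀ {w φ} → Λ ∋ w ∶ φ → φ ∈ S

    open Forest forest public

  Unused : List (Label × Formula) → Formula → Set
  Unused Γ φ = φ ∉ map proj₂ Γ

  unused? : ∀ Γ → Decidable (Unused Γ)
  unused? Γ φ = ¬? (φ ∈ᶠ? map proj₂ Γ)

  -- Replacing every label by its root turns occurrence of `φ` somewhere in the tree of `r` into
  -- decidable list membership.
  TreeLacks : (Label → Label) → List (Label × Formula) → Label × Formula → Set
  TreeLacks root Γ (r , φ) = root r ≡ r × (r , φ) ∉ map (map₁ root) Γ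

  treeLacks? : ∀ root Γ → Decidable (TreeLacks root Γ)
  treeLacks? root Γ (r , φ) = (root r ≟ r) ×-dec ¬? ((r , φ) ∈? map (map₁ root) Γ)

  root? : (root : Label → Label) → Decidable (λ r → root r ≡ r)
  root? root r = root r ≟ r

  lacks? : (Γ : List (Label × Formula)) → Decidable (_∉ Γ)
  lacks? Γ uφ = ¬? (uφ ∈? Γ)

  -- The components decrease in □-, [1]-, choice- and all other steps respectively.
  -- A tree is represented by its root.
  measure : ∀ {Λ} → Invariant Λ → ℕ × ℕ × ℕ × ℕ
  measure {Λ} inv =
      (# unused? (formulas Λ)) S
    , (# treeLacks? root (formulas Λ)) (cartesianProduct vertices S)
    , (# root? root) vertices
    , (# lacks? (formulas Λ)) (cartesianProduct vertices S)
    where open Invariant inv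

  Decrease : ∀ {Λ} → Invariant Λ → Sequent → Set
  Decrease inv Λ′ = ∃ λ (inv′ : Invariant Λ′) → measure inv′ ≺ measure inv

  module _ {Λ : Sequent} (inv : Invariant Λ) where
    open Invariant inv

    private
      R = relations Λ
      Γ = formulas Λ

    unused-mono : ∀ Δ {φ} → Unused (Δ ++ Γ) φ → Unused Γ φ
    unused-mono Δ unused φ∈ with uχ , uχ∈ , refl ← ∈-map⁻ proj₂ φ∈ =
      unused (∈-map⁺ proj₂ (∈-++⁺ʳ Δ uχ∈))

    treeLacks-mono : ∀ Δ {rφ} → TreeLacks root (Δ ++ Γ) rφ → TreeLacks root Γ rφ
    treeLacks-mono Δ (fixed , ∉) = fixed , λ ∈ →
      let uχ , uχ∈ , eq = ∈-map⁻ (map₁ root) ∈ in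
      ∉ (subst (_∈ map (map₁ root) (Δ ++ Γ)) (sym eq) (∈-map⁺ (map₁ root) (∈-++⁺ʳ Δ uχ∈)))

    labels-extend : ∀ Δ {P : Label → Set} →
                    (∀ {u χ} → (u , χ) ∈ Δ → P u) → (∀ {u} → u ∈ labels Λ → P u) →
                    ∀ {u} → u ∈ labels (R ∣ (Δ ++ Γ)) → P u
    labels-extend Δ new old u∈ with ∈-++⁻ (concatMap _ R) u∈
    ... | inj₁ u∈R = old (∈-++⁺ˡ u∈R)
    ... | inj₂ u∈ΔΓ with (u , χ) , uχ∈ , refl ← ∈-map⁻ proj₁ u∈ΔΓ with ∈-++⁻ Δ uχ∈
    ...   | inj₁ ∈Δ = new ∈Δ
    ...   | inj₂ ∈Γ = old (∋⇒label {Λ} ∈Γ)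

    known-extend : ∀ Δ → (∀ {u χ} → (u , χ) ∈ Δ → χ ∈ S) → ∀ {u χ} → (u , χ) ∈ Δ ++ Γ → χ ∈ S
    known-extend Δ Δ⊆S uχ∈ = [ Δ⊆S , known ]′ (∈-++⁻ Δ uχ∈)

    -- `Δ` has two members in the `∨`-step, one of which may already be present; a single absent one
    -- suffices. Forest and `vertices` stay fixed, so no earlier count grows and the absent pair
    -- leaves the last one.
    extend : ∀ Δ → (∀ {u χ} → (u , χ) ∈ Δ → u ∈ labels Λ × χ ∈ S) →
             ∀ {u χ} → (u , χ) ∈ Δ → (u , χ) ∉ Γ → Decrease inv (R ∣ (Δ ++ Γ))
    extend Δ Δ⊆ uχ∈Δ uχ∉Γ = inv′ ,
      inj₂ (#-mono (unused? Γ) (unused? (Δ ++ Γ)) (unused-mono Δ) S ,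
      inj₂ (#-mono (treeLacks? root Γ) (treeLacks? root (Δ ++ Γ)) (treeLacks-mono Δ)
              (cartesianProduct vertices S) ,
      inj₂ (≤-refl ,
      #-strict (lacks? Γ) (lacks? (Δ ++ Γ)) (λ ∉ ∈Γ → ∉ (∈-++⁺ʳ Δ ∈Γ))
        (∈-cartesianProduct⁺ (labels⊆ (proj₁ (Δ⊆ uχ∈Δ))) (proj₂ (Δ⊆ uχ∈Δ)))
        uχ∉Γ (λ ∉ → ∉ (∈-++⁺ˡ uχ∈Δ)))))
      where
      inv′ : Invariant (R ∣ (Δ ++ Γ))
      inv′ = record
        { forest   = Forest-relations forest refl
        ; vertices = vertices
        ; labels⊆  = labels-extend Δ (labels⊆ ∘ proj₁ ∘ Δ⊆) labels⊆
        ; known    = known-extend Δ (proj₂ ∘ Δ⊆)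
        }

    extend₁ : ∀ {u φ} → u ∈ labels Λ → φ ∈ S → Λ ∌ u ∶ φ → Decrease inv (Λ ⊕ u ∶ φ)
    extend₁ u∈ φ∈S = extend (_ ∷ []) (λ { (here refl) → u∈ , φ∈S }) (here refl)

    new-vertex : ∀ {v φ} → φ ∈ S → Invariant (Λ ⊕ v ∶ φ)
    new-vertex {v} {φ} φ∈S = record
      { forest   = Forest-relations forest refl
      ; vertices = v ∷ vertices
      ; labels⊆  = labels-extend ((v , φ) ∷ []) (λ { (here refl) → here refl }) (there ∘ labels⊆)
      ; known    = known-extend ((v , φ) ∷ []) (λ { (here refl) → φ∈S })
      }

    -- The added formula was absent everywhere, so the first count drops. This outweighs any growth
    -- of the others caused by the new vertex.
    □-decrease : ∀ {v φ} → φ ∈ S → (∀ u → u ∈ labels Λ → Λ ∌ u ∶ φ) → Decrease inv (Λ ⊕ v ∶ φ)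
    □-decrease {v} {φ} φ∈S none = new-vertex φ∈S ,
      inj₁ (#-strict (unused? Γ) (unused? ((v , φ) ∷ Γ)) (unused-mono ((v , φ) ∷ []))
              φ∈S unused (λ ∉ → ∉ (here refl)))
      where
      unused : Unused Γ φ
      unused φ∈ with (u , _) , u∶φ , refl ← ∈-map⁻ proj₂ φ∈ = none u (∋⇒label {Λ} u∶φ) u∶φ

  module _ {Λ : Sequent} (inv : Invariant Λ) where
    open Invariant inv

    module _ {x y} (x∈ : x ∈ labels Λ) (y∈ : y ∈ labels Λ)
             (y-root : root y ≡ y) (x∉CTy : root x ≢ y) where
      open Attach forest y-root x∉CTy

      attach-invariant : Invariant (Λ ⊕R x ∙ y)
      attach-invariant = record
        { forest   = attach
        ; vertices = vertices
        ; labels⊆  = λ { (here refl)         → labels⊆ x∈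
                       ; (there (here refl)) → labels⊆ y∈
                       ; (there (there u∈))  → labels⊆ u∈ }
        ; known    = known
        }

      -- A root that survives is an old root other than `y`, and the labels of its old tree keep it
      -- as their root. So its tree loses no formula.
      treeLacks-attach : ∀ {rφ} → TreeLacks root′ (formulas Λ) rφ → TreeLacks root (formulas Λ) rφ
      treeLacks-attach (fixed′ , ∉) with fixed , r≢y ← root′-fixed fixed′ = fixed , λ ∈ →
        let (u , φ) , uφ∈ , eq = ∈-map⁻ (map₁ root) ∈
            kept = root′-kept (λ u↦y → r≢y (trans (cong proj₁ eq) u↦y)) in
        ∉ (subst (_∈ map (map₁ root′) (formulas Λ))
                 (trans (cong (_, φ) kept) (sym eq))
                 (∈-map⁺ (map₁ root′) uφ∈))

      choice-decrease : Decrease inv (Λ ⊕R x ∙ y)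
      choice-decrease = attach-invariant ,
        inj₂ (≤-refl ,
        inj₂ (#-mono (treeLacks? root (formulas Λ)) (treeLacks? root′ (formulas Λ)) treeLacks-attach
                (cartesianProduct vertices S) ,
        inj₁ (#-strict (root? root) (root? root′) (proj₁ ∘ root′-fixed) (labels⊆ y∈) y-root
                (λ fixed′ → proj₂ (root′-fixed fixed′) refl))))

  module _ {Λ : Sequent} (inv : Invariant Λ) where
    open Invariant inv

    -- Two stages: `inv₁` adds `v` as an isolated tree carrying `φ`, and `inv₂` attaches it below
    -- `w`. The first count is only bounded weakly, since `φ` may already occur in another tree.
    [1]-decrease : ∀ {w v φ} → φ ∈ S → w ∈ labels Λ → v ∉ labels Λ →
                   (∀ u → u ∈CT[ Λ ] w → Λ ∌ u ∶ φ) → Decrease inv (Λ ⊕ v ∶ φ ⊕R w ∙ v)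
    [1]-decrease {w} {v} {φ} φ∈S w∈ v∉ none = inv₂ ,
      inj₂ (#-mono (unused? Γ) (unused? Γ₁) (unused-mono inv ((v , φ) ∷ [])) S ,
      inj₁ (subst (_< _) (sym without-v)
             (#-strict (treeLacks? root Γ) (treeLacks? root′ Γ₁)
                (treeLacks-mono inv ((v , φ) ∷ []) ∘ treeLacks-attach₁)
                -- The pair leaving the count is `(root w , φ)`: by `none` the tree of `w` lacked
                -- `φ`, and now `v` supplies it.
                (∈-cartesianProduct⁺ (labels⊆ (root-label w∈)) φ∈S)
                (root-idem w , λ ∈ →
                  let (u , _) , u∶φ , eq = ∈-map⁻ (map₁ root) ∈ in
                  none u (root≡⇒CT (cong proj₁ eq))
                    (subst (λ χ → Λ ∋ u ∶ χ) (sym (cong proj₂ eq)) u∶φ))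
                (λ (_ , ∉) → ∉ (here (cong (_, φ) (sym (root′-moved v-root))))))))
      where
      Γ  = formulas Λ
      Γ₁ = (v , φ) ∷ Γ

      v-root : root v ≡ v
      v-root = root-nonlabel v∉

      w∉CTv : root w ≢ v
      w∉CTv eq = v∉ (subst (_∈ labels Λ) eq (root-label w∈))

      inv₁ : Invariant (Λ ⊕ v ∶ φ)
      inv₁ = new-vertex inv φ∈S

      open Attach (Invariant.forest inv₁) v-root w∉CTv

      w∈₁ : w ∈ labels (Λ ⊕ v ∶ φ)
      w∈₁ = [ ∈-++⁺ˡ , (λ w∈ → ∈-++⁺ʳ (concatMap _ (relations Λ)) (there w∈)) ]′
              (∈-++⁻ (concatMap _ (relations Λ)) w∈)

      v∈₁ : v ∈ labels (Λ ⊕ v ∶ φ)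
      v∈₁ = ∋⇒label {Λ ⊕ v ∶ φ} (here refl)

      inv₂ : Invariant (Λ ⊕ v ∶ φ ⊕R w ∙ v)
      inv₂ = attach-invariant inv₁ w∈₁ v∈₁ v-root w∉CTv

      treeLacks-attach₁ : ∀ {rφ} → TreeLacks root′ Γ₁ rφ → TreeLacks root Γ₁ rφ
      treeLacks-attach₁ = treeLacks-attach inv₁ w∈₁ v∈₁ v-root w∉CTv

      v-lacks-nothing : All (λ rφ → ¬ TreeLacks root′ Γ₁ rφ) (map (v ,_) S)
      v-lacks-nothing = All.map⁺ (All.tabulate λ _ (fixed′ , _) → proj₂ (root′-fixed fixed′) refl)

      -- The new vertex enlarges the index set by the pairs `(v , ψ)`. They contribute nothing
      -- because `v` is not a root after the attachment, so both counts can be compared over the old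
      -- vertices.
      without-v : (# treeLacks? root′ Γ₁) (cartesianProduct (v ∷ vertices) S)
                ≡ (# treeLacks? root′ Γ₁) (cartesianProduct vertices S)
      without-v = cong length (trans
        (filter-++ (treeLacks? root′ Γ₁) (map (v ,_) S) (cartesianProduct vertices S))
        (cong (_++ filter (treeLacks? root′ Γ₁) (cartesianProduct vertices S))
              (filter-none (treeLacks? root′ Γ₁) v-lacks-nothing)))

  module _ {n : ℕ} {Λ : Sequent} (inv : Invariant Λ) where
    open Invariant inv

    private
      label : ∀ {w φ} → Λ ∋ w ∶ φ → w ∈ labels Λ
      label = ∋⇒label {Λ}

      part : ∀ {w φ χ} → Λ ∋ w ∶ φ → χ ∈ properSubformulas φ → χ ∈ S
      part w∶φ = S-closed (known w∶φ)

      right : ∀ φ {ψ} → ψ ∈ subformulas φ ++ subformulas ψ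
      right φ = ∈-++⁺ʳ (subformulas φ) (here refl)

    -- Stated for `Step` and not `Prove`: each clause decreases the measure by itself, whatever the
    -- order of the clauses.
    calls-decrease : ∀ {k o} → Step n k Λ o → All (Decrease inv) (calls o)
    calls-decrease (closed _ _ _ _) = []
    calls-decrease (stable _)       = []
    calls-decrease (∨-step w φ ψ w∈ _ (w∶ , absent)) =
      [ extend inv Δ Δ⊆ (here refl) , extend inv Δ Δ⊆ (there (here refl)) ]′ absent ∷ []
      where
      Δ = (w , φ) ∷ (w , ψ) ∷ []
      Δ⊆ : ∀ {u χ} → (u , χ) ∈ Δ → u ∈ labels Λ × χ ∈ S
      Δ⊆ (here refl)         = w∈ , part w∶ (here refl)
      Δ⊆ (there (here refl)) = w∈ , part w∶ (right φ)
    calls-decrease (∧-step w φ ψ w∈ _ _ w∶ w∌φ w∌ψ) =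
      extend₁ inv w∈ (part w∶ (here refl)) w∌φ ∷ extend₁ inv w∈ (part w∶ (right φ)) w∌ψ ∷ []
    calls-decrease (⟨1⟩-step w φ u w∶ u∈ u∌) =
      extend₁ inv (CT-label (label w∶) u∈) (part w∶ (here refl)) u∌ ∷ []
    calls-decrease (◇-step w φ u w∶ u∈ u∌) = extend₁ inv u∈ (part w∶ (here refl)) u∌ ∷ []
    calls-decrease ([1]-step w φ v w∶ none v∉) =
      [1]-decrease inv (part w∶ (here refl)) (label w∶) v∉ none ∷ []
    calls-decrease (□-step w φ v w∶ none _) = □-decrease inv (part w∶ (here refl)) none ∷ []
    calls-decrease (choice-step ws _ _ _ unique ws-roots) =
      All.map⁺ (All.map
        -- Since `root` fixes both ends, distinct roots lie in distinct trees, as `Attach` requires.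
        (λ { {x , y} (x-root , y-root , x≢y) →
             choice-decrease inv (proj₁ x-root) (proj₁ y-root) (Root⇒fixed y-root)
               (λ eq → x≢y (trans (sym (Root⇒fixed x-root)) eq)) })
        (pairs⁺ ws-roots unique))

  Invariant⇒Terminates : ∀ {n Λ} (inv : Invariant Λ) → Acc _≺_ (measure inv) → Terminates n Λ
  Invariant⇒Terminates {n} inv (acc rec) = terminates
    (Progress.progress n S-closed known forest)
    (λ (_ , s , _) → All.map
      (λ (inv′ , smaller) → Invariant⇒Terminates inv′ (rec smaller)) (calls-decrease inv s))
    where open Invariant inv

theorem6 : (n : ℕ) (φ : Formula) (w : Label) → Terminates n (initial w φ)
theorem6 n φ w = Invariant⇒Terminates start (≺-wellFounded _)
  where
  open Descent (subformulas φ) (subformulas-trans φ)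

  start : Invariant (initial w φ)
  start = record
    { forest   = record
      -- Without relational atoms every number is a one-vertex tree, reached only by the empty path.
      { root      = id
      ; root-edge = λ ()
      ; root-path = λ u → [] , stop , λ { stop → refl }
      }
    ; vertices = w ∷ []
    ; labels⊆  = id
    ; known    = λ { (here refl) → here refl }
    }
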